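{- Let $k$ be a natural number. The class of $k$-threshold graphs is characterized by a finite collection of forbidden induced subgraphs; that is, there is a finite set $\mathcal{O}_k$ of graphs such that a graph $G$ is a $k$-threshold graph if and only if no induced subgraph of $G$ is isomorphic to a member of $\mathcal{O}_k$.
   Context: Graphs are finite and simple. Let $k$ be a natural number and let $C=\{1,\ldots,k\}$ be a set of colors; a coloring of $G=(V,E)$ is any map $c:V\to C$ (no properness condition). A graph $G=(V,E)$ is a $k$-threshold graph if there is a coloring of $G$ with $k$ colors such that for every nonempty set $W\subseteq V$ the induced graph $G[W]$ has a vertex $x$ which is either isolated in $G[W]$, or is adjacent to exactly all vertices of color $i$ in $W\setminus\{x\}$ for some color $i$ (and to no other vertices of $W$). -}

module Defs where

open import Data.Nat using (ℕ)
open import Data.Fin using (Fin)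
open import Data.Fin.Subset using (Subset; _∈_; Nonempty)
open import Data.Bool using (Bool; true; false)
open import Data.Product using (Σ; ∃; _×_; _,_)
open import Data.Sum using (_⊎_)
open import Relation.Binary.PropositionalEquality using (_≡_)
open import Relation.Nullary using (¬_)
open import Function.Definitions using (Injective)
open import Function.Bundles using (_⇔_)

record Graph : Set where
  field
    order : ℕ
    adj   : Fin order → Fin order → Bool
    sym   : ∀ x y → adj x y ≡ adj y x
    irrefl : ∀ x → adj x x ≡ false

open Graph public

Coloring : ℕ → Graph → Set
Coloring k G = Fin (order G) → Fin k

IsolatedIn : (G : Graph) → Subset (order G) → Fin (order G) → Set
IsolatedIn G W x = ∀ y → y ∈ W → ¬ (y ≡ x) → adj G x y ≡ false

AdjExactlyColor : (G : Graph) {k : ℕ} → Coloring k G → Subset (order G)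
                → Fin (order G) → Fin k → Set
AdjExactlyColor G c W x i =
  ∀ y → y ∈ W → ¬ (y ≡ x) → (adj G x y ≡ true ⇔ c y ≡ i)

IsThreshold : ℕ → Graph → Set
IsThreshold k G =
  Σ (Coloring k G) λ c →
    ∀ (W : Subset (order G)) → Nonempty W →
      Σ (Fin (order G)) λ x → x ∈ W ×
        (IsolatedIn G W x ⊎ Σ (Fin k) λ i → AdjExactlyColor G c W x i)

InducedSub : Graph → Graph → Set
InducedSub H G =
  Σ (Fin (order H) → Fin (order G)) λ f →
    Injective _≡_ _≡_ f × (∀ a b → adj H a b ≡ adj G (f a) (f b))

{-# OPTIONS --safe #-}

-- If deleting one vertex v from G leaves a k-threshold graph, then G is described by a word over
-- an alphabet that depends only on k: list the other vertices in the order of elimination, each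
-- with its color, the color it is joined to among the later vertices, and its adjacency to v.
-- Being k-threshold is a monadic second-order property of such a word (there is a coloring such
-- that no nonempty set of positions is stuck), hence has finite Myhill–Nerode index N.  If G has
-- more than N vertices then two suffixes of its word are equivalent, and cutting out the segment
-- between them leaves a proper induced subgraph which is k-threshold only if G is.  So every
-- graph that is not k-threshold contains one with at most N vertices.

module Submission where

open import Defs
open import Data.Bool using (Bool; true; false; _∧_; _∨_; not)
import Data.Bool.Properties as Bool
open import Data.Fin using (Fin; zero; suc; toℕ; combine; _<_)
import Data.Fin.Properties as Fin
open import Data.Fin.Subset using (Subset; Nonempty; ∣_∣; _-_; ⊤) renaming (_∈_ to _∈ˢ_)
import Data.Fin.Subset.Properties as Subset
open import Data.List using (List; []; _∷_; _++_; map; concatMap; filter; length; lookup; take; drop; tabulate; allFin; upTo; cartesianProduct; cartesianProductWith)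
import Data.List.Properties as List
open import Data.List.Membership.Propositional using (_∈_; find; lose)
import Data.List.Membership.DecPropositional as DecMembership
open import Data.List.Membership.Propositional.Properties
open import Data.List.Relation.Binary.Sublist.Propositional using (_∷_; _∷ʳ_; []) renaming (_⊆_ to _⊑_; ⊆-refl to ⊑-refl)
open import Data.List.Relation.Binary.Sublist.Propositional.Properties using (All-resp-⊆; drop⁺-≥) renaming (++⁺ to ⊑-++⁺)
open import Data.List.Relation.Binary.Subset.Propositional using (_⊆_)
import Data.List.Relation.Binary.Subset.Propositional.Properties as ListSubset
open import Data.List.Relation.Unary.All as All using (All; []; _∷_)
open import Data.List.Relation.Unary.AllPairs using (AllPairs; []; _∷_)
import Data.List.Relation.Unary.AllPairs.Properties as AllPairs
open import Data.List.Relation.Unary.Any as Any using (Any; here; there)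
import Data.List.Relation.Unary.Any.Properties as Any
open import Data.Nat as ℕ using (ℕ; zero; suc; _*_; _≤_; s≤s)
open import Data.Nat.Induction using (<-wellFounded)
import Data.Nat.Properties as ℕ
open import Data.Product using (Σ; ∃; _×_; _,_; proj₁; proj₂)
import Data.Product.Properties as Product
open import Data.Sum using (_⊎_; inj₁; inj₂)
import Data.Sum as Sum
open import Data.Vec as Vec using (Vec; []; _∷_)
import Data.Vec.Properties as Vec
open import Function using (_∘_; id)
open import Function.Bundles using (_⇔_; mk⇔; Equivalence)
open import Function.Definitions using (Injective)
open import Induction.WellFounded using (Acc; acc)
open import Relation.Binary using (DecidableEquality; tri<; tri≈; tri>)
open import Relation.Binary.PropositionalEquality as ≡ using (_≡_; _≢_; refl; cong; subst)
open import Relation.Nullary using (¬_; Dec; yes; no; does; contradiction)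
open import Relation.Nullary.Decidable using (¬?; _×-dec_; _⊎-dec_; _→-dec_; map′; decidable-stable)
open import Relation.Unary using (Decidable)

open Equivalence using (to; from)

private variable
  A B : Set

-- Lists, vectors and subsets

AllPairs-resp-⊑ : {R : A → A → Set} {xs ys : List A} → xs ⊑ ys → AllPairs R ys → AllPairs R xs
AllPairs-resp-⊑ []         []       = []
AllPairs-resp-⊑ (_ ∷ʳ s)   (_ ∷ ps) = AllPairs-resp-⊑ s ps
AllPairs-resp-⊑ (refl ∷ s) (p ∷ ps) = All-resp-⊆ s p ∷ AllPairs-resp-⊑ s ps

AllPairs-lookup : {R : A → A → Set} {xs : List A} → AllPairs R xs →
                  ∀ {i j} → i < j → R (lookup xs i) (lookup xs j)
AllPairs-lookup (p ∷ ps) {zero}  {suc j} _         = All.lookup p (∈-lookup j)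
AllPairs-lookup (p ∷ ps) {suc i} {suc j} (s≤s i<j) = AllPairs-lookup ps i<j

length-cut : (xs : List A) {i j : ℕ} → i ℕ.< j → j ≤ length xs →
             length (take i xs ++ drop j xs) ℕ.< length xs
length-cut (x ∷ xs) {zero}  {suc j} _         (s≤s j≤) =
  s≤s (subst (_≤ length xs) (≡.sym (List.length-drop j xs)) (ℕ.m∸n≤m (length xs) j))
length-cut (x ∷ xs) {suc i} {suc j} (s≤s i<j) (s≤s j≤) = s≤s (length-cut xs i<j j≤)

vectors : List A → (n : ℕ) → List (Vec A n)
vectors xs zero    = [] ∷ []
vectors xs (suc n) = cartesianProductWith _∷_ xs (vectors xs n)

∈-vectors : {xs : List A} → (∀ x → x ∈ xs) → ∀ {n} (v : Vec A n) → v ∈ vectors xs n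
∈-vectors all []      = here refl
∈-vectors all (x ∷ v) = ∈-cartesianProductWith⁺ _∷_ (all x) (∈-vectors all v)

∈-booleans : ∀ b → b ∈ true ∷ false ∷ []
∈-booleans true  = here refl
∈-booleans false = there (here refl)

module _ {n : ℕ} {P : Fin n → Set} (P? : Decidable P) where

  comprehension : Subset n
  comprehension = Vec.tabulate (does ∘ P?)

  ∈-comprehension⁺ : ∀ {x} → P x → x ∈ˢ comprehension
  ∈-comprehension⁺ {x} px =
    Vec.lookup⇒[]= x _ (≡.trans (Vec.lookup∘tabulate (does ∘ P?) x) does-true)
    where
    does-true : does (P? x) ≡ true
    does-true with P? x
    ... | yes _  = refl
    ... | no ¬px = contradiction px ¬px

  ∈-comprehension⁻ : ∀ {x} → x ∈ˢ comprehension → P x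
  ∈-comprehension⁻ {x} x∈ with P? x | ≡.trans (≡.sym (Vec.lookup∘tabulate (does ∘ P?) x)) (Vec.[]=⇒lookup x∈)
  ... | yes px | _ = px

y∈p-x⇒y≢x : ∀ {n} {p : Subset n} {x y} → y ∈ˢ p - x → y ≢ x
y∈p-x⇒y≢x {p = _ ∷ p}     {zero}  ()            refl
y∈p-x⇒y≢x {p = true ∷ p}  {suc x} (Vec.there y∈) refl = y∈p-x⇒y≢x {p = p} y∈ refl
y∈p-x⇒y≢x {p = false ∷ p} {suc x} (Vec.there y∈) refl = y∈p-x⇒y≢x {p = p} y∈ refl

-- Languages of finite index

-- `τ` codes a right-to-left Myhill-Nerode classification: suffixes of equal code cannot be told
-- apart by a common prefix `u`. Equality of codes is symmetric, so one implication yields the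
-- equivalence.
FiniteIndex : (List A → Set) → Set
FiniteIndex {A} L =
  Σ ℕ λ N → Σ (List A → Fin N) λ τ →
    ∀ {v w} → τ v ≡ τ w → ∀ u → L (u ++ v) → L (u ++ w)

decCode : Dec A → Fin 2
decCode (yes _) = zero
decCode (no _)  = suc zero

decCode-transport : (p : Dec A) (q : Dec B) → decCode p ≡ decCode q → A → B
decCode-transport _       (yes b) _ _ = b
decCode-transport (no ¬a) (no _)  _ a = contradiction a ¬a

-- Packs one decision bit per index in `is` into a single number, giving 2 to the power `length is`
-- classes.
profile : {I : Set} {P : I → A → Set} → (∀ i x → Dec (P i x)) → (is : List I) →
          Σ ℕ λ N → Σ (A → Fin N) λ τ →
            ∀ {x y} → τ x ≡ τ y → ∀ {i} → i ∈ is → P i x → P i y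
profile P? []       = 1 , (λ _ → zero) , λ _ ()
profile {P = P} P? (i ∷ is) with profile P? is
... | N , τ , sound = 2 * N , (λ x → combine (decCode (P? i x)) (τ x)) , sound′
  where
  sound′ : ∀ {x y} → combine (decCode (P? i x)) (τ x) ≡ combine (decCode (P? i y)) (τ y) →
           ∀ {j} → j ∈ i ∷ is → P j x → P j y
  sound′ {x} {y} eq j∈ with Fin.combine-injective (decCode (P? i x)) (τ x) (decCode (P? i y)) (τ y) eq | j∈
  ... | eq₁ , _   | here refl = decCode-transport (P? i x) (P? i y) eq₁
  ... | _   , eq₂ | there j∈′ = sound eq₂ j∈′

finiteIndex-∁ : {L : List A → Set} → FiniteIndex L → FiniteIndex (¬_ ∘ L)
finiteIndex-∁ (N , τ , sound) = N , τ , λ eq u ¬l l → ¬l (sound (≡.sym eq) u l)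

module _ (σ : A → List (List B)) where

  -- A finite substitution applied letter by letter. It serves as a second-order quantifier:
  -- choosing a word from `σ x` at each position can choose a set of positions (`subwords`) or a
  -- coloring (`coloredWords`).
  expand : List A → List (List B)
  expand []       = [] ∷ []
  expand (x ∷ xs) = cartesianProductWith _++_ (σ x) (expand xs)

  -- The powerset construction: the new class of `v` records which old classes occur among the
  -- expansions of `v`.
  finiteIndex-expand : {L : List B → Set} → FiniteIndex L → FiniteIndex (Any L ∘ expand)
  finiteIndex-expand {L} (N , τ , sound)
    with profile (λ t v → Any.any? (λ w → τ w Fin.≟ t) (expand v)) (allFin N)
  ... | N′ , τ′ , sound′ = N′ , τ′ , λ eq u l → go eq u [] l
    where
    -- `p` accumulates the expansions already chosen for the letters stripped from the common
    -- prefix.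
    go : ∀ {v w} → τ′ v ≡ τ′ w → ∀ u p →
         Any (λ z → L (p ++ z)) (expand (u ++ v)) → Any (λ z → L (p ++ z)) (expand (u ++ w))
    go eq [] p l with find l
    ... | z , z∈ , lz with find (sound′ eq (∈-allFin (τ z)) (lose z∈ refl))
    ... | z′ , z′∈ , eq′ = lose z′∈ (sound (≡.sym eq′) p lz)
    go {v} {w} eq (x ∷ u) p l with find l
    ... | z , z∈ , lz with ∈-cartesianProductWith⁻ _++_ (σ x) (expand (u ++ v)) z∈
    ... | s , t , s∈ , t∈ , refl
      with find (go eq u (p ++ s) (lose t∈ (subst L (≡.sym (List.++-assoc p s t)) lz)))
    ... | t′ , t′∈ , l′ =
      lose (∈-cartesianProductWith⁺ _++_ s∈ t′∈) (subst L (List.++-assoc p s t′) l′)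

subwords : List A → List (List A)
subwords = expand (λ x → [] ∷ (x ∷ []) ∷ [])

map-filter∈subwords : {P : A → Set} (P? : Decidable P) (g : A → B) (xs : List A) →
                      map g (filter P? xs) ∈ subwords (map g xs)
map-filter∈subwords P? g [] = here refl
map-filter∈subwords P? g (x ∷ xs) with P? x
... | yes _ = ∈-cartesianProductWith⁺ _++_ {xs = [] ∷ (g x ∷ []) ∷ []} (there (here refl)) (map-filter∈subwords P? g xs)
... | no  _ = ∈-cartesianProductWith⁺ _++_ {xs = [] ∷ (g x ∷ []) ∷ []} (here refl) (map-filter∈subwords P? g xs)

∈-subwords-map : (g : A → B) (xs : List A) {w : List B} → w ∈ subwords (map g xs) →
                 ∃ λ zs → zs ⊑ xs × w ≡ map g zs
∈-subwords-map g [] (here refl) = [] , [] , refl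
∈-subwords-map g (x ∷ xs) w∈
  with ∈-cartesianProductWith⁻ _++_ ([] ∷ (g x ∷ []) ∷ []) (subwords (map g xs)) w∈
... | s , t , s∈ , t∈ , refl with ∈-subwords-map g xs t∈ | s∈
... | zs , sub , refl | here refl         = zs , x ∷ʳ sub , refl
... | zs , sub , refl | there (here refl) = x ∷ zs , refl ∷ sub , refl

-- Before q x y and After q x y say that a letter y standing before, respectively after, x
-- refutes the claim q about x.  A word is stuck if all claims about its letters are refuted;
-- S holds the letters already read.
module _ {m : ℕ} (Before After : Fin m → A → A → Set) where

  Stuck : List A → List A → Set
  Stuck S []      = ∃ λ y → y ∈ S
  Stuck S (x ∷ v) = (∀ q → Any (Before q x) S ⊎ Any (After q x) v) × Stuck (x ∷ S) v

  stuck? : (∀ q x y → Dec (Before q x y)) → (∀ q x y → Dec (After q x y)) →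
           ∀ S v → Dec (Stuck S v)
  stuck? b? a? []      []      = no λ ()
  stuck? b? a? (y ∷ S) []      = yes (y , here refl)
  stuck? b? a? S       (x ∷ v) =
    Fin.all? (λ q → Any.any? (b? q x) S ⊎-dec Any.any? (a? q x) v) ×-dec stuck? b? a? (x ∷ S) v

  stuck-mono : ∀ {S S′} v → S ⊆ S′ → Stuck S v → Stuck S′ v
  stuck-mono []      sub (y , y∈)  = y , sub y∈
  stuck-mono (x ∷ v) sub (h , st) =
    (λ q → Sum.map₁ (ListSubset.Any-resp-⊆ sub) (h q)) , stuck-mono v (ListSubset.∷⁺ʳ x sub) st

  -- Two pieces of information on a suffix `v` suffice: which letters occur in it, for claims about
  -- letters of the prefix, and for which sets `S` of earlier letters `Stuck S v` holds. Over a
  -- finite alphabet both are finite.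
  finiteIndex-stuck : DecidableEquality A → (elems : List A) → (∀ x → x ∈ elems) →
                      (∀ q x y → Dec (Before q x y)) → (∀ q x y → Dec (After q x y)) →
                      FiniteIndex (Stuck [])
  finiteIndex-stuck _≟_ elems complete b? a?
    with profile (λ x v → DecMembership._∈?_ _≟_ x v) elems
       | profile (stuck? b? a?) (subwords elems)
  ... | N₁ , τ₁ , sound₁ | N₂ , τ₂ , sound₂ =
    N₁ * N₂ , (λ v → combine (τ₁ v) (τ₂ v)) , λ {v} {w} eq u →
      let eq₁ , eq₂ = Fin.combine-injective (τ₁ v) (τ₂ v) (τ₁ w) (τ₂ w) eq in go eq₁ eq₂ u []
    where
    go : ∀ {v w} → τ₁ v ≡ τ₁ w → τ₂ v ≡ τ₂ w → ∀ u S → Stuck S (u ++ v) → Stuck S (u ++ w)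
    go {v} {w} eq₁ eq₂ [] S st =
      -- By `stuck-mono` only the set of letters in `S` matters, so `S` may be exchanged for
      -- `filter ∈S? elems`, one of the finitely many lists that `τ₂` tests, and exchanged back
      -- afterwards.
      stuck-mono w (λ x∈ → proj₂ (∈-filter⁻ ∈S? {xs = elems} x∈))
        (sound₂ eq₂ canonical∈
          (stuck-mono v (λ x∈ → ∈-filter⁺ ∈S? (complete _) x∈) st))
      where
      ∈S? = λ x → DecMembership._∈?_ _≟_ x S
      canonical∈ : filter ∈S? elems ∈ subwords elems
      canonical∈ = ≡.subst₂ (λ ys zs → ys ∈ subwords zs) (List.map-id _) (List.map-id elems)
                     (map-filter∈subwords ∈S? id elems)
    go eq₁ eq₂ (x ∷ u) S (h , st) =
      (λ q → Sum.map₂ (ListSubset.Any-resp-⊆ (ListSubset.++⁺ʳ u (λ {y} → sound₁ eq₁ (complete y)))) (h q))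
      , go eq₁ eq₂ u (x ∷ S) st

-- Eliminable vertices

-- The rule zero says "isolated", the rule suc i says "adjacent exactly to color i".
match : ∀ {k} → Fin (suc k) → Fin k → Bool
match zero    c = false
match (suc i) c = does (c Fin.≟ i)

module _ {k : ℕ} (G : Graph) (c : Coloring k G) where

  Obeys : Subset (order G) → Fin (order G) → Fin (suc k) → Set
  Obeys W x q = ∀ y → y ∈ˢ W → y ≢ x → adj G x y ≡ match q (c y)

  Eliminable : Subset (order G) → Fin (order G) → Set
  Eliminable W x = x ∈ˢ W × ∃ (Obeys W x)

  obeys? : ∀ W x q → Dec (Obeys W x q)
  obeys? W x q = Fin.all? λ y →
    (y Subset.∈? W) →-dec (¬? (y Fin.≟ x) →-dec (adj G x y Bool.≟ match q (c y)))

  eliminable? : ∀ W x → Dec (Eliminable W x)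
  eliminable? W x = (x Subset.∈? W) ×-dec Fin.any? (obeys? W x)

  disobeys : ∀ {W x q} → ¬ Obeys W x q → ∃ λ y → y ∈ˢ W × y ≢ x × adj G x y ≢ match q (c y)
  disobeys {W} {x} {q} ¬ob =
    decidable-stable
      (Fin.any? λ y → (y Subset.∈? W) ×-dec (¬? (y Fin.≟ x) ×-dec ¬? (adj G x y Bool.≟ match q (c y))))
      λ ¬ex → ¬ob λ y y∈ y≢ → decidable-stable (adj G x y Bool.≟ match q (c y)) λ ne → ¬ex (y , y∈ , y≢ , ne)

  true⇔≡match : ∀ b i y → (b ≡ true ⇔ c y ≡ i) ⇔ (b ≡ match (suc i) (c y))
  true⇔≡match b i y with c y Fin.≟ i
  true⇔≡match true  i y | yes eq = mk⇔ (λ _ → refl) (λ _ → mk⇔ (λ _ → eq) (λ _ → refl))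
  true⇔≡match false i y | yes eq = mk⇔ (λ e → from e eq) (λ ())
  true⇔≡match true  i y | no ¬eq = mk⇔ (λ e → contradiction (to e refl) ¬eq) (λ ())
  true⇔≡match false i y | no ¬eq = mk⇔ (λ _ → refl) (λ _ → mk⇔ (λ ()) (λ eq → contradiction eq ¬eq))

  ∃obeys⇔ : ∀ W x → ∃ (Obeys W x) ⇔ (IsolatedIn G W x ⊎ Σ (Fin k) (AdjExactlyColor G c W x))
  ∃obeys⇔ W x = mk⇔ f g
    where
    f : ∃ (Obeys W x) → IsolatedIn G W x ⊎ Σ (Fin k) (AdjExactlyColor G c W x)
    f (zero  , ob) = inj₁ ob
    f (suc i , ob) = inj₂ (i , λ y y∈ y≢ → from (true⇔≡match (adj G x y) i y) (ob y y∈ y≢))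
    g : IsolatedIn G W x ⊎ Σ (Fin k) (AdjExactlyColor G c W x) → ∃ (Obeys W x)
    g (inj₁ iso)      = zero , iso
    g (inj₂ (i , ad)) = suc i , λ y y∈ y≢ → to (true⇔≡match (adj G x y) i y) (ad y y∈ y≢)

  Dismantlable : Set
  Dismantlable = ∀ W → Nonempty W → ∃ (Eliminable W)

  dismantlable? : Dec Dismantlable
  dismantlable? = map′
    (λ ¬ex W ne → decidable-stable (Fin.any? (eliminable? W)) λ ¬el → ¬ex (W , ne , ¬el))
    (λ d (W , ne , ¬el) → ¬el (d W ne))
    (¬? (Subset.anySubset? λ W → Subset.nonempty? W ×-dec ¬? (Fin.any? (eliminable? W))))

-- Decidability and heredity of the threshold property

isThreshold⇔ : ∀ k G → IsThreshold k G ⇔ ∃ (Dismantlable {k} G)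
isThreshold⇔ k G = mk⇔
  (λ (c , h) → c , λ W ne → let x , x∈ , g = h W ne in x , x∈ , from (∃obeys⇔ G c W x) g)
  (λ (c , h) → c , λ W ne → let x , x∈ , g = h W ne in x , x∈ , to (∃obeys⇔ G c W x) g)

dismantlable-cong : ∀ {k} G {c d : Coloring k G} → (∀ x → c x ≡ d x) → Dismantlable G c → Dismantlable G d
dismantlable-cong G c≗d h W ne =
  let x , x∈ , q , ob = h W ne
  in x , x∈ , q , λ y y∈ y≢ → ≡.trans (ob y y∈ y≢) (cong (match q) (c≗d y))

-- Searches all colorings, listed as vectors. A coloring and the lookup function of its vector agree
-- only pointwise, which is where `dismantlable-cong` enters.
isThreshold? : ∀ k G → Dec (IsThreshold k G)
isThreshold? k G = map′
  (λ a → let v , _ , d = find a in from (isThreshold⇔ k G) (Vec.lookup v , d))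
  (λ t → let c , d = to (isThreshold⇔ k G) t in
    lose (∈-vectors ∈-allFin (Vec.tabulate c))
         (dismantlable-cong G (λ x → ≡.sym (Vec.lookup∘tabulate c x)) d))
  (Any.any? (λ v → dismantlable? G (Vec.lookup v)) (vectors (allFin k) (order G)))

inducedSub-trans : ∀ {F G H} → InducedSub F G → InducedSub G H → InducedSub F H
inducedSub-trans (f , f-inj , f-adj) (g , g-inj , g-adj) =
  g ∘ f , f-inj ∘ g-inj , λ a b → ≡.trans (f-adj a b) (g-adj (f a) (f b))

-- The coloring is pulled back along `f`; an eliminable vertex of the image of `W` has an eliminable
-- preimage in `W`.
isThreshold-hereditary : ∀ {k} H G → InducedSub H G → IsThreshold k G → IsThreshold k H
isThreshold-hereditary {k} H G (f , f-inj , f-adj) t with to (isThreshold⇔ k G) t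
... | c , d = from (isThreshold⇔ k H) (c ∘ f , d′)
  where
  image? : ∀ W → Decidable λ y → ∃ λ a → a ∈ˢ W × f a ≡ y
  image? W y = Fin.any? λ a → (a Subset.∈? W) ×-dec (f a Fin.≟ y)
  d′ : Dismantlable H (c ∘ f)
  d′ W (a , a∈)
    with d (comprehension (image? W)) (f a , ∈-comprehension⁺ (image? W) (a , a∈ , refl))
  ... | x , x∈ , q , ob with ∈-comprehension⁻ (image? W) x∈
  ... | b , b∈ , refl =
    b , b∈ , q , λ y y∈ y≢ →
      ≡.trans (f-adj b y) (ob (f y) (∈-comprehension⁺ (image? W) (y , y∈ , refl)) (y≢ ∘ f-inj))

-- Words describing graphs

-- Label, rule obeyed among the later vertices, adjacency to the exceptional vertex.  The
-- exceptional vertex has label zero, a vertex of color i has label suc i.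
Letter : ℕ → Set
Letter k = Fin (suc k) × Fin (suc k) × Bool

-- The first argument is the earlier letter: its rule or bit decides the adjacency, and the later
-- letter contributes only its label.
joined : ∀ {k} → Letter k → Letter k → Bool
joined (_ , _ , b) (zero  , _) = b
joined (_ , q , _) (suc i , _) = match q i

module _ {k : ℕ} where

  -- The added color is the candidate coloring of the whole graph. It is independent of the color in
  -- the label, which comes from the graph without the exceptional vertex.
  Colored : Set
  Colored = Letter k × Fin k

  Before After : Fin (suc k) → Colored → Colored → Set
  Before q (x , _) (y , j) = joined y x ≢ match q j
  After  q (x , _) (y , j) = joined x y ≢ match q j

  coloredWords : List (Letter k) → List (List Colored)
  coloredWords = expand λ x → map (λ i → (x , i) ∷ []) (allFin k)

  -- The second-order formula: some coloring of the positions leaves no set of positions stuck.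
  Threshold : List (Letter k) → Set
  Threshold = Any (λ w → ¬ Any (Stuck Before After []) (subwords w)) ∘ coloredWords

  coloredLetters : List Colored
  coloredLetters =
    cartesianProduct
      (cartesianProduct (allFin _) (cartesianProduct (allFin _) (true ∷ false ∷ [])))
      (allFin _)

  ∈-coloredLetters : ∀ x → x ∈ coloredLetters
  ∈-coloredLetters ((l , q , b) , i) =
    ∈-cartesianProduct⁺
      (∈-cartesianProduct⁺ (∈-allFin l) (∈-cartesianProduct⁺ (∈-allFin q) (∈-booleans b)))
      (∈-allFin i)

  abstract
    -- Follows the formula from the inside: stuckness, existence of a set, negation, existence of a
    -- coloring. Each `expand` exponentiates the number of classes, and `abstract` keeps that number
    -- from being unfolded.
    finiteIndex-threshold : FiniteIndex Threshold
    finiteIndex-threshold =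
      finiteIndex-expand _
        (finiteIndex-∁ {L = Any (Stuck Before After []) ∘ subwords}
          (finiteIndex-expand _ {L = Stuck Before After []}
            (finiteIndex-stuck Before After
              (Product.≡-dec (Product.≡-dec Fin._≟_ (Product.≡-dec Fin._≟_ Bool._≟_)) Fin._≟_)
              coloredLetters ∈-coloredLetters
              (λ _ _ _ → ¬? (_ Bool.≟ _)) (λ _ _ _ → ¬? (_ Bool.≟ _)))))

  tabulate∈coloredWords : ∀ {n} (ℓ : Fin n → Letter k) (c : Fin n → Fin k) →
                          tabulate (λ i → ℓ i , c i) ∈ coloredWords (tabulate ℓ)
  tabulate∈coloredWords {zero}  ℓ c = here refl
  tabulate∈coloredWords {suc n} ℓ c =
    ∈-cartesianProductWith⁺ _++_ (∈-map⁺ _ (∈-allFin (c zero))) (tabulate∈coloredWords (ℓ ∘ suc) (c ∘ suc))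

  ∈-coloredWords-tabulate : ∀ {n} (ℓ : Fin n → Letter k) {w} → w ∈ coloredWords (tabulate ℓ) →
                            ∃ λ (c : Fin n → Fin k) → w ≡ tabulate (λ i → ℓ i , c i)
  ∈-coloredWords-tabulate {zero}  ℓ (here refl) = (λ ()) , refl
  ∈-coloredWords-tabulate {suc n} ℓ w∈
    with ∈-cartesianProductWith⁻ _++_ (map (λ i → (ℓ zero , i) ∷ []) (allFin k)) (coloredWords (tabulate (ℓ ∘ suc))) w∈
  ... | s , t , s∈ , t∈ , refl with ∈-map⁻ _ s∈ | ∈-coloredWords-tabulate (ℓ ∘ suc) t∈
  ... | i , _ , refl | c , refl = (λ { zero → i ; (suc j) → c j }) , refl

-- Translation between graphs and their words

module _ {k : ℕ} (G : Graph) (ℓ : Fin (order G) → Letter k)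
         (adj-joined : ∀ {x y} → x < y → adj G x y ≡ joined (ℓ x) (ℓ y)) where

  module _ (c : Coloring k G) where

    Blocked : Subset (order G) → Fin (order G) → Set
    Blocked W x = ∀ q → ∃ λ y → y ∈ˢ W × y ≢ x × adj G x y ≢ match q (c y)

    color : Fin (order G) → Colored
    color x = ℓ x , c x

    adj-joined′ : ∀ {x y} → y < x → adj G x y ≡ joined (ℓ y) (ℓ x)
    adj-joined′ y<x = ≡.trans (Graph.sym G _ _) (adj-joined y<x)

    -- `ps` mirrors the letters already read. A refuting letter stems from a vertex of `ps` or of
    -- the remaining list, and its side fixes the order in which `joined` gives the adjacency.
    stuck⇒blocked : ∀ W ps zs → AllPairs _<_ zs → All (λ p → All (p <_) zs) ps →
                    All (_∈ˢ W) ps → All (_∈ˢ W) zs →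
                    Stuck Before After (map color ps) (map color zs) → All (Blocked W) zs
    stuck⇒blocked W ps [] _ _ _ _ _ = []
    stuck⇒blocked W ps (z ∷ zs) (z< ∷ zs<) ps< ps∈ (z∈ ∷ zs∈) (h , st) =
      blocked ∷ stuck⇒blocked W (z ∷ ps) zs zs< (z< ∷ All.map All.tail ps<) (z∈ ∷ ps∈) zs∈ st
      where
      blocked : Blocked W z
      blocked q with h q
      ... | inj₁ a with find (Any.map⁻ a)
      ... | y , y∈ , ne =
        let y<z = All.head (All.lookup ps< y∈)
        in y , All.lookup ps∈ y∈ , Fin.<⇒≢ y<z , λ eq → ne (≡.trans (≡.sym (adj-joined′ y<z)) eq)
      blocked q | inj₂ a with find (Any.map⁻ a)
      ... | y , y∈ , ne =
        let z<y = All.lookup z< y∈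
        in y , All.lookup zs∈ y∈ , Fin.<⇒≢ z<y ∘ ≡.sym , λ eq → ne (≡.trans (≡.sym (adj-joined z<y)) eq)

    blocked⇒stuck : ∀ W ps zs → AllPairs _<_ zs → All (λ p → All (p <_) zs) ps →
                    (∀ {y} → y ∈ˢ W → y ∈ ps ⊎ y ∈ zs) → Nonempty W → All (Blocked W) zs →
                    Stuck Before After (map color ps) (map color zs)
    blocked⇒stuck W ps [] _ _ cover (y , y∈) _ with cover y∈
    ... | inj₁ y∈ps = color y , ∈-map⁺ color y∈ps
    blocked⇒stuck W ps (z ∷ zs) (z< ∷ zs<) ps< cover ne (b ∷ bs) =
      refuted , blocked⇒stuck W (z ∷ ps) zs zs< (z< ∷ All.map All.tail ps<) cover′ ne bs
      where
      cover′ : ∀ {y} → y ∈ˢ W → y ∈ z ∷ ps ⊎ y ∈ zs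
      cover′ y∈ with cover y∈
      ... | inj₁ y∈ps        = inj₁ (there y∈ps)
      ... | inj₂ (here refl) = inj₁ (here refl)
      ... | inj₂ (there y∈′) = inj₂ y∈′
      refuted : ∀ q → Any (Before q (color z)) (map color ps) ⊎ Any (After q (color z)) (map color zs)
      refuted q with b q
      ... | y , y∈ , y≢ , neq with cover y∈
      ... | inj₁ y∈ps = inj₁ (Any.map⁺ (lose y∈ps λ eq → neq (≡.trans (adj-joined′ (All.head (All.lookup ps< y∈ps))) eq)))
      ... | inj₂ (here refl) = contradiction refl y≢
      ... | inj₂ (there y∈′) = inj₂ (Any.map⁺ (lose y∈′ λ eq → neq (≡.trans (adj-joined (All.lookup z< y∈′)) eq)))

    allFin-sorted : AllPairs _<_ (allFin (order G))
    allFin-sorted = AllPairs.tabulate⁺-< id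

    tabulate-color : map color (allFin (order G)) ≡ tabulate color
    tabulate-color = List.map-tabulate id color

    dismantlable⇒¬stuck : Dismantlable G c → ¬ Any (Stuck Before After []) (subwords (tabulate color))
    dismantlable⇒¬stuck d stuck with find stuck
    ... | w , w∈ , st
      with ∈-subwords-map color (allFin (order G)) (subst (λ t → w ∈ subwords t) (≡.sym tabulate-color) w∈)
    -- The empty word is not stuck, as the base case of `Stuck` demands a letter; this matches the
    -- restriction to nonempty `W`.
    dismantlable⇒¬stuck d stuck | _ , _ , (_ , ()) | [] , _ , refl
    dismantlable⇒¬stuck d stuck | _ , _ , st | zs@(z ∷ _) , sub , refl =
      let x , x∈ , q , ob = d W (z , ∈-comprehension⁺ ∈zs? (here refl))
          blocked = stuck⇒blocked W [] zs (AllPairs-resp-⊑ sub allFin-sorted) [] []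
                      (All.tabulate (∈-comprehension⁺ ∈zs?)) st
          y , y∈ , y≢ , ne = All.lookup blocked (∈-comprehension⁻ ∈zs? x∈) q
      in ne (ob y y∈ y≢)
      where
      ∈zs? = λ x → DecMembership._∈?_ Fin._≟_ x zs
      W = comprehension ∈zs?

    ¬stuck⇒dismantlable : ¬ Any (Stuck Before After []) (subwords (tabulate color)) → Dismantlable G c
    ¬stuck⇒dismantlable ¬stuck W ne = decidable-stable (Fin.any? (eliminable? G c W)) λ ¬el →
      ¬stuck (lose
        (subst (λ t → map color zs ∈ subwords t) tabulate-color (map-filter∈subwords (Subset._∈? W) color (allFin (order G))))
        (blocked⇒stuck W [] zs (AllPairs.filter⁺ (Subset._∈? W) allFin-sorted) []
          (λ y∈ → inj₂ (∈-filter⁺ (Subset._∈? W) (∈-allFin _) y∈)) ne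
          (All.tabulate λ x∈ q → disobeys G c {q = q} λ ob →
            ¬el (_ , proj₂ (∈-filter⁻ (Subset._∈? W) {xs = allFin _} x∈) , q , ob))))
      where
      zs = filter (Subset._∈? W) (allFin (order G))

  isThreshold⇔threshold : IsThreshold k G ⇔ Threshold (tabulate ℓ)
  isThreshold⇔threshold = mk⇔
    (λ t → let c , d = to (isThreshold⇔ k G) t in lose (tabulate∈coloredWords ℓ c) (dismantlable⇒¬stuck c d))
    λ t → from (isThreshold⇔ k G) (fromWord (find t))
    where
    fromWord : (∃ λ w → w ∈ coloredWords (tabulate ℓ) × ¬ Any (Stuck Before After []) (subwords w)) →
               ∃ (Dismantlable G)
    fromWord (w , w∈ , ¬st) with ∈-coloredWords-tabulate ℓ w∈
    ... | c , refl = c , ¬stuck⇒dismantlable c ¬st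

-- Shrinking large obstructions

module _ {k : ℕ} (G : Graph) where

  Described : List (Fin (order G) × Letter k) → Set
  Described = AllPairs λ (x , a) (y , b) → x ≢ y × adj G x y ≡ joined a b

  induced : List (Fin (order G) × Letter k) → Graph
  induced xs = record
    { order  = length xs
    ; adj    = λ i j → adj G (vertex i) (vertex j)
    ; sym    = λ i j → Graph.sym G (vertex i) (vertex j)
    ; irrefl = λ i → irrefl G (vertex i)
    }
    where
    vertex : Fin (length xs) → Fin (order G)
    vertex i = proj₁ (lookup xs i)

  induced-sub : ∀ {xs} → Described xs → InducedSub (induced xs) G
  induced-sub {xs} d = proj₁ ∘ lookup xs , inj , λ _ _ → refl
    where
    inj : Injective _≡_ _≡_ (proj₁ ∘ lookup xs)
    inj {i} {j} eq with Fin.<-cmp i j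
    ... | tri< i<j _ _ = contradiction eq (proj₁ (AllPairs-lookup d i<j))
    ... | tri≈ _ i≡j _ = i≡j
    ... | tri> _ _ j<i = contradiction (≡.sym eq) (proj₁ (AllPairs-lookup d j<i))

  -- Each vertex is sent to a position where it is listed. With `induced-sub` this gives embeddings
  -- both ways for a complete listing, in place of an isomorphism.
  induced-super : ∀ {xs} → (∀ x → Any (λ e → proj₁ e ≡ x) xs) → InducedSub G (induced xs)
  induced-super {xs} cover = index , inj , λ a b → ≡.sym (≡.cong₂ (adj G) (vertex-index a) (vertex-index b))
    where
    index : Fin (order G) → Fin (length xs)
    index x = Any.index (cover x)
    vertex-index : ∀ x → proj₁ (lookup xs (index x)) ≡ x
    vertex-index x = Any.lookup-index (cover x)
    inj : Injective _≡_ _≡_ index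
    inj {a} {b} eq = ≡.trans (≡.sym (vertex-index a))
                       (≡.trans (cong (proj₁ ∘ lookup xs) eq) (vertex-index b))

  induced-threshold : ∀ {xs} → Described xs → IsThreshold k (induced xs) ⇔ Threshold (map proj₂ xs)
  induced-threshold {xs} d =
    subst (λ w → IsThreshold k (induced xs) ⇔ Threshold w)
      (≡.trans (≡.sym (List.map-tabulate (lookup xs) proj₂)) (cong (map proj₂) (List.tabulate-lookup xs)))
      (isThreshold⇔threshold (induced xs) (proj₂ ∘ lookup xs) (λ i<j → proj₂ (AllPairs-lookup d i<j)))

bound : ℕ → ℕ
bound k = proj₁ (finiteIndex-threshold {k})

shrink : ∀ {k} G (xs : List (Fin (order G) × Letter k)) → Described G xs →
         (∀ x → Any (λ e → proj₁ e ≡ x) xs) → bound k ℕ.< order G → ¬ IsThreshold k G →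
         ∃ λ H → order H ℕ.< order G × InducedSub H G × ¬ IsThreshold k H
shrink {k} G xs d cover large ¬t
  -- The suffixes starting at 0 up to `bound k` are one more than the classes, and all these starts
  -- lie within the word because `G` has more than `bound k` vertices.
  with Fin.pigeonhole (ℕ.n<1+n (bound k)) (λ i → proj₁ (proj₂ finiteIndex-threshold) (map proj₂ (drop (toℕ i) xs)))
... | i , j , i<j , eq =
  induced G ys , ℕ.<-≤-trans (length-cut xs i<j j≤) xs≤ , induced-sub G dys ,
  λ t → ¬t (isThreshold-hereditary G (induced G xs) (induced-super G cover) (from (induced-threshold G d) (restore t)))
  where
  ys = take (toℕ i) xs ++ drop (toℕ j) xs
  xs≤ : length xs ≤ order G
  xs≤ = Fin.injective⇒≤ (proj₁ (proj₂ (induced-sub G d)))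
  j≤ : toℕ j ≤ length xs
  j≤ = ℕ.≤-trans (ℕ.≤-pred (Fin.toℕ<n j))
         (ℕ.≤-trans (ℕ.<⇒≤ large) (Fin.injective⇒≤ (proj₁ (proj₂ (induced-super G cover)))))
  dys : Described G ys
  dys = AllPairs-resp-⊑
          (subst (ys ⊑_) (List.take++drop≡id (toℕ i) xs)
            (⊑-++⁺ (⊑-refl {x = take (toℕ i) xs}) (drop⁺-≥ (ℕ.<⇒≤ i<j)))) d
  -- Behind the common prefix `take (toℕ i) xs`, the suffix from `j` is exchanged for the equivalent
  -- suffix from `i`, which undoes the cut.
  restore : IsThreshold k (induced G ys) → Threshold (map proj₂ xs)
  restore t = subst Threshold
    (≡.trans (≡.sym (List.map-++ proj₂ (take (toℕ i) xs) _)) (cong (map proj₂) (List.take++drop≡id (toℕ i) xs)))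
    (proj₂ (proj₂ finiteIndex-threshold) (≡.sym eq) (map proj₂ (take (toℕ i) xs))
      (subst Threshold (List.map-++ proj₂ (take (toℕ i) xs) _) (to (induced-threshold G dys) t)))

-- Words from elimination orders

module _ {k : ℕ} {H G : Graph} (sub : InducedSub H G) (v : Fin (order G))
         (f≢v : ∀ a → proj₁ sub a ≢ v) (c : Coloring k H) (d : Dismantlable H c) where

  private
    f = proj₁ sub

  Entry : Subset (order H) → Fin (order G) × Letter k → Set
  Entry W (y , l , _) = (y ≡ v × l ≡ zero) ⊎ ∃ λ a → a ∈ˢ W × y ≡ f a × l ≡ suc (c a)

  -- Put an eliminable vertex `x` of `W` first and recurse on `W - x`: the rule that `x` obeys in
  -- `W` gives its adjacency to all later vertices other than `v`, and the bit gives its adjacency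
  -- to `v`.
  elimination : ∀ W → Acc ℕ._<_ ∣ W ∣ →
    ∃ λ xs → Described G xs × All (Entry W) xs × Any (λ e → proj₁ e ≡ v) xs ×
             (∀ a → a ∈ˢ W → Any (λ e → proj₁ e ≡ f a) xs)
  elimination W (acc rec) with Subset.nonempty? W
  ... | no ¬ne =
    -- `v` stands last, so its rule `zero` and bit `false` are mere defaults: `joined` reads these
    -- from the earlier letter of a pair.
    (v , zero , zero , false) ∷ [] , [] ∷ [] , inj₁ (refl , refl) ∷ [] , here refl ,
    λ a a∈ → contradiction (a , a∈) ¬ne
  ... | yes ne with d W ne
  ... | x , x∈ , q , ob with elimination (W - x) (rec (Subset.x∈p⇒∣p-x∣<∣p∣ x∈))
  ... | xs , described , entries , v∈ , cover =
    (f x , letter) ∷ xs , All.map describes entries ∷ described ,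
    inj₂ (x , x∈ , refl , refl) ∷ All.map (λ {e} → weaken {e}) entries , there v∈ , cover′
    where
    letter : Letter k
    letter = suc (c x) , q , adj G (f x) v
    ∈W : ∀ {a} → a ∈ˢ W - x → a ∈ˢ W
    ∈W = Subset.p─q⊆p W _
    describes : ∀ {e} → Entry (W - x) e → f x ≢ proj₁ e × adj G (f x) (proj₁ e) ≡ joined letter (proj₂ e)
    describes (inj₁ (refl , refl)) = f≢v x , refl
    describes (inj₂ (a , a∈ , refl , refl)) =
      (λ eq → y∈p-x⇒y≢x {p = W} a∈ (≡.sym (proj₁ (proj₂ sub) eq))) ,
      ≡.trans (≡.sym (proj₂ (proj₂ sub) x a)) (ob a (∈W a∈) (y∈p-x⇒y≢x {p = W} a∈))
    weaken : ∀ {e} → Entry (W - x) e → Entry W e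
    weaken = Sum.map₂ λ (a , a∈ , eqs) → a , ∈W a∈ , eqs
    cover′ : ∀ a → a ∈ˢ W → Any (λ e → proj₁ e ≡ f a) ((f x , letter) ∷ xs)
    cover′ a a∈ with a Fin.≟ x
    ... | yes refl = here refl
    ... | no a≢x   = there (cover a (Subset.x∈p∧x≢y⇒x∈p-y a∈ a≢x))

-- Descent to an obstruction of bounded order

deleteZero : (G : Graph) {n : ℕ} → order G ≡ suc n →
  Σ Graph λ H → Σ (InducedSub H G) λ sub → Σ (Fin (order G)) λ v →
    order H ℕ.< order G × (∀ a → proj₁ sub a ≢ v) × (∀ x → x ≡ v ⊎ ∃ λ a → x ≡ proj₁ sub a)
deleteZero record { order = suc n ; adj = adj ; sym = sym ; irrefl = irrefl } refl =
  record { order = n ; adj = λ x y → adj (suc x) (suc y)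
         ; sym = λ x y → sym (suc x) (suc y) ; irrefl = λ x → irrefl (suc x) } ,
  (suc , Fin.suc-injective , λ _ _ → refl) , zero , ℕ.n<1+n n , (λ _ ()) ,
  λ { zero → inj₁ refl ; (suc a) → inj₂ (a , refl) }

-- Delete one vertex: either the rest is already an obstruction, or its elimination order supplies a
-- word for `G` that `shrink` can cut.
smallerObstruction : ∀ {k} G → bound k ℕ.< order G → ¬ IsThreshold k G →
                     ∃ λ H → order H ℕ.< order G × InducedSub H G × ¬ IsThreshold k H
smallerObstruction {k} G large ¬t
  with deleteZero G (≡.sym (ℕ.suc-pred (order G) {{ℕ.>-nonZero (ℕ.≤-<-trans ℕ.z≤n large)}}))
... | H , sub , v , smaller , f≢v , split with isThreshold? k H
... | no ¬tH = H , smaller , sub , ¬tH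
... | yes tH with to (isThreshold⇔ k H) tH
... | c , d with elimination {H = H} {G} sub v f≢v c d ⊤ (<-wellFounded _)
... | xs , described , _ , v∈ , cover = shrink G xs described cover′ large ¬t
  where
  cover′ : ∀ x → Any (λ e → proj₁ e ≡ x) xs
  cover′ x with split x
  ... | inj₁ refl       = v∈
  ... | inj₂ (a , refl) = cover a Subset.∈⊤

smallObstruction : ∀ {k} G → Acc ℕ._<_ (order G) → ¬ IsThreshold k G →
                   ∃ λ H → order H ≤ bound k × InducedSub H G × ¬ IsThreshold k H
smallObstruction {k} G (acc rec) ¬t with order G ℕ.≤? bound k
... | yes small = G , small , (id , id , λ _ _ → refl) , ¬t
... | no ¬small with smallerObstruction G (ℕ.≰⇒> ¬small) ¬t
... | H , smaller , sub , ¬tH with smallObstruction H (rec smaller) ¬tH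
... | F , small , sub′ , ¬tF = F , small , inducedSub-trans {F} {H} {G} sub′ sub , ¬tF

-- All graphs of a given order

-- Symmetrizing and clearing the diagonal turns every Boolean matrix into a graph, while an
-- adjacency matrix gives back the same adjacencies.
fromMatrix : ∀ {n} → Vec (Vec Bool n) n → Graph
fromMatrix {n} m = record { order = n ; adj = edge ; sym = edge-sym ; irrefl = edge-irrefl }
  where
  entry edge : Fin n → Fin n → Bool
  entry i j = Vec.lookup (Vec.lookup m i) j
  edge i j = not (does (i Fin.≟ j)) ∧ (entry i j ∨ entry j i)
  edge-sym : ∀ i j → edge i j ≡ edge j i
  edge-sym i j with i Fin.≟ j | j Fin.≟ i
  ... | yes _   | yes _   = refl
  ... | no _    | no _    = Bool.∨-comm (entry i j) (entry j i)
  ... | yes i≡j | no j≢i  = contradiction (≡.sym i≡j) j≢i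
  ... | no i≢j  | yes j≡i = contradiction (≡.sym j≡i) i≢j
  edge-irrefl : ∀ i → edge i i ≡ false
  edge-irrefl i with i Fin.≟ i
  ... | yes _  = refl
  ... | no i≢i = contradiction refl i≢i

matrix : (G : Graph) → Vec (Vec Bool (order G)) (order G)
matrix G = Vec.tabulate λ i → Vec.tabulate (adj G i)

adj-fromMatrix : ∀ G i j → adj (fromMatrix (matrix G)) i j ≡ adj G i j
adj-fromMatrix G i j with i Fin.≟ j
... | yes refl = ≡.sym (irrefl G i)
... | no _     = ≡.trans (≡.cong₂ _∨_ (entry i j) (≡.trans (entry j i) (Graph.sym G j i))) (Bool.∨-idem (adj G i j))
  where
  entry : ∀ i j → Vec.lookup (Vec.lookup (matrix G) i) j ≡ adj G i j
  entry i j = ≡.trans (cong (λ v → Vec.lookup v j) (Vec.lookup∘tabulate (λ i → Vec.tabulate (adj G i)) i))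
                (Vec.lookup∘tabulate (adj G i) j)

graphs : ℕ → List Graph
graphs n = map fromMatrix (vectors (vectors (true ∷ false ∷ []) n) n)

matrix∈graphs : ∀ G → fromMatrix (matrix G) ∈ graphs (order G)
matrix∈graphs G = ∈-map⁺ fromMatrix (∈-vectors (∈-vectors ∈-booleans) (matrix G))

-- All non-threshold graphs up to the bound are taken, minimal or not; by heredity none of them
-- embeds in a threshold graph. `upTo` excludes its argument, hence the `suc`.
obstructions : ℕ → List Graph
obstructions k = filter (¬? ∘ isThreshold? k) (concatMap graphs (upTo (suc (bound k))))

theorem1 : (k : ℕ) → Σ (List Graph) λ O →
    ∀ (G : Graph) → (IsThreshold k G ⇔ (∀ H → H ∈ O → ¬ InducedSub H G))
theorem1 k = obstructions k , λ G → mk⇔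
  (λ t H H∈ sub → proj₂ (∈-filter⁻ (¬? ∘ isThreshold? k) {xs = concatMap graphs (upTo (suc (bound k)))} H∈)
                    (isThreshold-hereditary H G sub t))
  (λ free → decidable-stable (isThreshold? k G) λ ¬t →
    let H , small , sub , ¬tH = smallObstruction G (<-wellFounded _) ¬t
        -- The list contains graphs built from matrices, so `H` is replaced by the copy with
        -- pointwise equal adjacency.
        copy = fromMatrix (matrix H)
        copy⊑H : InducedSub copy H
        copy⊑H = id , id , adj-fromMatrix H
        H⊑copy : InducedSub H copy
        H⊑copy = id , id , λ a b → ≡.sym (adj-fromMatrix H a b)
        copy∈ = ∈-filter⁺ (¬? ∘ isThreshold? k)
                  (∈-concatMap⁺ graphs (lose (∈-upTo⁺ (s≤s small)) (matrix∈graphs H)))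
                  (¬tH ∘ isThreshold-hereditary H copy H⊑copy)
    in free copy copy∈ (inducedSub-trans {copy} {H} {G} copy⊑H sub))
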